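{- Suppose $G$ is a finite group admitting a skew-Hadamard difference set, and let $G'=[G,G]$ be its commutator subgroup. Then $\sqrt{ -|G|}\in\mathbb{Q}(\zeta_d)$ for all positive integers $d$ such that there is a cyclic subgroup of order $d$ in $G/G'$, where $\zeta_d$ denotes a primitive $d$-th root of unity.
   Context: Let $G$ be a finite group of order $v$. A $(v,k,\lambda)$ difference set in $G$ is a subset $D\subseteq G$ of size $k$ such that each non-identity element of $G$ can be written as $d_1d_2^{ -1}$ with $d_1\neq d_2$ in $D$ in exactly $\lambda$ distinct ways. A skew-Hadamard difference set (SHDS) in $G$ is a difference set $D$ such that $G$ is the disjoint union of $D$, $D^{(-1)}$ and $\{1\}$, where $D^{(-1)}=\{d^{ -1}: d\in D\}$. We say that $G$ admits an SHDS if such a $D\subseteq G$ exists.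
   Formalization: The formal statement requires d > 1: for d = 1 (the trivial cyclic subgroup) the claim would say that √(−|G|) is rational, which is false for every finite group, e.g. G = ℤ/3 with D = {1}. -}

module Defs where

open import Level using (Level; _⊔_; suc)
open import Algebra.Bundles using (Group; CommutativeRing; Semiring)
open import Algebra.Apartness.Bundles
  using (HeytingCommutativeRing; HeytingField)
import Algebra.Definitions.RawSemiring as RawSemiringDefs
import Algebra.Properties.Group as GroupProperties
import Relation.Binary.Construct.On as On
import Relation.Binary.Reasoning.Setoid as SetoidReasoning
open import Data.Fin.Base using (Fin)
open import Data.Nat.Base using (ℕ; _<_)
open import Data.Product.Base using (Σ; ∃; ∃₂; _×_; _,_; proj₁)
open import Data.Product.Relation.Binary.Pointwise.NonDependent using (_×ₛ_)
open import Function.Bundles using (Inverse)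
open import Relation.Binary.Bundles using (Setoid)
open import Relation.Binary.Definitions using (_Respects_)
open import Relation.Binary.PropositionalEquality.Properties as ≡ using ()
open import Relation.Nullary.Negation.Core using (¬_)
open import Relation.Unary using (Pred; _∈_; _∪_; _⊥_; Universal)

private
  variable
    a ℓ p : Level

HasCardinality : Setoid a ℓ → ℕ → Set (a ⊔ ℓ)
HasCardinality S n = Inverse S (≡.setoid (Fin n))

-- The elements of a subset are compared in the ambient setoid, so different
-- membership proofs for one element are not counted separately.
subsetoid : (S : Setoid a ℓ) → Pred (Setoid.Carrier S) p → Setoid (a ⊔ p) ℓ
subsetoid S P = On.setoid {B = ∃ P} S proj₁

module _ (G : Group a ℓ) where
  open Group G

  data Generated (S : Pred Carrier p) : Pred Carrier (a ⊔ ℓ ⊔ p) where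
    gen  : ∀ {x} → x ∈ S → Generated S x
    ε∈   : Generated S ε
    ∙∈   : ∀ {x y} → Generated S x → Generated S y → Generated S (x ∙ y)
    ⁻¹∈  : ∀ {x} → Generated S x → Generated S (x ⁻¹)
    resp : ∀ {x y} → x ≈ y → Generated S x → Generated S y

  record IsNormalSubgroup (N : Pred Carrier p) : Set (a ⊔ ℓ ⊔ p) where
    field
      respects    : N Respects _≈_
      ε-closed    : ε ∈ N
      ∙-closed    : ∀ {x y} → x ∈ N → y ∈ N → x ∙ y ∈ N
      ⁻¹-closed   : ∀ {x} → x ∈ N → x ⁻¹ ∈ N
      conj-closed : ∀ g {x} → x ∈ N → g ∙ x ∙ g ⁻¹ ∈ N

  -- G / N has the carrier of G, with x and y identified when x y⁻¹ ∈ N.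
  quotientGroup : {N : Pred Carrier p} → IsNormalSubgroup N → Group a p
  quotientGroup {N = N} normal = record
    { Carrier = Carrier
    ; _≈_     = _~_
    ; _∙_     = _∙_
    ; ε       = ε
    ; _⁻¹     = _⁻¹
    ; isGroup = record
      { isMonoid = record
        { isSemigroup = record
          { isMagma = record
            { isEquivalence = record
              { refl  = ≈⇒~ refl
              ; sym   = ~-sym
              ; trans = ~-trans
              }
            ; ∙-cong = ~-∙-cong
            }
          ; assoc = λ x y z → ≈⇒~ (assoc x y z)
          }
        ; identity = (λ x → ≈⇒~ (identityˡ x)) , (λ x → ≈⇒~ (identityʳ x))
        }
      ; inverse = (λ x → ≈⇒~ (inverseˡ x)) , (λ x → ≈⇒~ (inverseʳ x))
      ; ⁻¹-cong = ~-⁻¹-cong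
      }
    }
    where
    open IsNormalSubgroup normal
    open GroupProperties G
    open SetoidReasoning setoid

    _~_ : Carrier → Carrier → Set _
    x ~ y = x ∙ y ⁻¹ ∈ N

    ≈⇒~ : ∀ {x y} → x ≈ y → x ~ y
    ≈⇒~ x≈y = respects (sym (x≈y⇒x∙y⁻¹≈ε x≈y)) ε-closed

    ~-sym : ∀ {x y} → x ~ y → y ~ x
    ~-sym {x} {y} h = respects eq (⁻¹-closed h)
      where
      eq : (x ∙ y ⁻¹) ⁻¹ ≈ y ∙ x ⁻¹
      eq = trans (⁻¹-anti-homo-∙ x (y ⁻¹)) (∙-congʳ (⁻¹-involutive y))

    telescope : ∀ x y z → (x ∙ y ⁻¹) ∙ (y ∙ z) ≈ x ∙ z
    telescope x y z = begin
      (x ∙ y ⁻¹) ∙ (y ∙ z) ≈⟨ assoc x (y ⁻¹) (y ∙ z) ⟩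
      x ∙ (y ⁻¹ ∙ (y ∙ z)) ≈⟨ ∙-congˡ (\\-leftDividesʳ y z) ⟩
      x ∙ z                ∎

    ~-trans : ∀ {x y z} → x ~ y → y ~ z → x ~ z
    ~-trans {x} {y} {z} h k = respects (telescope x y (z ⁻¹)) (∙-closed h k)

    ~-∙-cong : ∀ {x y u v} → x ~ y → u ~ v → (x ∙ u) ~ (y ∙ v)
    ~-∙-cong {x} {y} {u} {v} h k =
      respects eq (∙-closed (conj-closed x k) h)
      where
      eq : (x ∙ (u ∙ v ⁻¹) ∙ x ⁻¹) ∙ (x ∙ y ⁻¹) ≈ (x ∙ u) ∙ (y ∙ v) ⁻¹
      eq = begin
        (x ∙ (u ∙ v ⁻¹) ∙ x ⁻¹) ∙ (x ∙ y ⁻¹) ≈⟨ telescope _ x (y ⁻¹) ⟩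
        (x ∙ (u ∙ v ⁻¹)) ∙ y ⁻¹              ≈⟨ ∙-congʳ (assoc x u (v ⁻¹)) ⟨
        ((x ∙ u) ∙ v ⁻¹) ∙ y ⁻¹              ≈⟨ assoc (x ∙ u) (v ⁻¹) (y ⁻¹) ⟩
        (x ∙ u) ∙ (v ⁻¹ ∙ y ⁻¹)              ≈⟨ ∙-congˡ (⁻¹-anti-homo-∙ y v) ⟨
        (x ∙ u) ∙ (y ∙ v) ⁻¹                 ∎

    ~-⁻¹-cong : ∀ {x y} → x ~ y → (x ⁻¹) ~ (y ⁻¹)
    ~-⁻¹-cong {x} {y} h = respects eq (conj-closed (x ⁻¹) (~-sym h))
      where
      eq : x ⁻¹ ∙ (y ∙ x ⁻¹) ∙ (x ⁻¹) ⁻¹ ≈ x ⁻¹ ∙ (y ⁻¹) ⁻¹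
      eq = begin
        x ⁻¹ ∙ (y ∙ x ⁻¹) ∙ (x ⁻¹) ⁻¹   ≈⟨ assoc (x ⁻¹) (y ∙ x ⁻¹) ((x ⁻¹) ⁻¹) ⟩
        x ⁻¹ ∙ ((y ∙ x ⁻¹) ∙ (x ⁻¹) ⁻¹) ≈⟨ ∙-congˡ (//-rightDividesʳ (x ⁻¹) y) ⟩
        x ⁻¹ ∙ y                        ≈⟨ ∙-congˡ (⁻¹-involutive y) ⟨
        x ⁻¹ ∙ (y ⁻¹) ⁻¹                ∎

  IsCommutator : Pred Carrier (a ⊔ ℓ)
  IsCommutator z = ∃₂ λ x y → z ≈ x ∙ y ∙ x ⁻¹ ∙ y ⁻¹

  commutatorSubgroup : Pred Carrier (a ⊔ ℓ)
  commutatorSubgroup = Generated IsCommutator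

  commutatorSubgroup-normal : IsNormalSubgroup commutatorSubgroup
  commutatorSubgroup-normal = record
    { respects    = resp
    ; ε-closed    = ε∈
    ; ∙-closed    = ∙∈
    ; ⁻¹-closed   = ⁻¹∈
    ; conj-closed = λ g {x} x∈ →
        resp (GroupProperties.//-rightDividesˡ G x (g ∙ x ∙ g ⁻¹))
             (∙∈ (gen (g , x , refl)) x∈)
    }

  abelianization : Group a (a ⊔ ℓ)
  abelianization = quotientGroup commutatorSubgroup-normal

  HasCyclicSubgroupOfOrder : ℕ → Set (a ⊔ ℓ)
  HasCyclicSubgroupOfOrder d =
    ∃ λ g → HasCardinality (subsetoid setoid (Generated (_≈ g))) d

  Representation : Pred Carrier p → Carrier → Pred (Carrier × Carrier) (ℓ ⊔ p)
  Representation D g (d₁ , d₂) =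
    d₁ ∈ D × d₂ ∈ D × ¬ (d₁ ≈ d₂) × d₁ ∙ d₂ ⁻¹ ≈ g

  record IsDifferenceSet (k l : ℕ) (D : Pred Carrier p) : Set (a ⊔ ℓ ⊔ p) where
    field
      respects        : D Respects _≈_
      size            : HasCardinality (subsetoid setoid D) k
      representations : ∀ g → ¬ (g ≈ ε) →
        HasCardinality (subsetoid (setoid ×ₛ setoid) (Representation D g)) l

  InverseSet : Pred Carrier p → Pred Carrier (a ⊔ ℓ ⊔ p)
  InverseSet D x = ∃ λ d → d ∈ D × x ≈ d ⁻¹

  record IsSkewHadamardDifferenceSet (D : Pred Carrier p) : Set (a ⊔ ℓ ⊔ p) where
    field
      isDifferenceSet : ∃₂ λ k l → IsDifferenceSet k l D
      covers          : Universal (D ∪ InverseSet D ∪ (_≈ ε))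
      D⊥D⁻¹           : D ⊥ InverseSet D
      D⊥ε             : D ⊥ (_≈ ε)
      D⁻¹⊥ε           : InverseSet D ⊥ (_≈ ε)

AdmitsSHDS : (p : Level) → Group a ℓ → Set (a ⊔ ℓ ⊔ suc p)
AdmitsSHDS p G = Σ (Pred (Group.Carrier G) p) (IsSkewHadamardDifferenceSet G)

module _ {f ℓ₁ ℓ₂ : Level} (K : HeytingField f ℓ₁ ℓ₂) where
  open HeytingField K
  open HeytingCommutativeRing heytingCommutativeRing using (commutativeRing)
  open RawSemiringDefs (Semiring.rawSemiring (CommutativeRing.semiring commutativeRing))
    using (_^_) renaming (_×_ to _·_)

  fromℕ : ℕ → Carrier
  fromℕ n = n · 1#

  -- Apartness from 0# is invertibility, so this says that ℚ embeds in K.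
  CharacteristicZero : Set ℓ₂
  CharacteristicZero = ∀ n → 0 < n → fromℕ n # 0#

  IsPrimitiveRoot : ℕ → Carrier → Set ℓ₁
  IsPrimitiveRoot d ζ = ζ ^ d ≈ 1# × (∀ j → 0 < j → j < d → ¬ (ζ ^ j ≈ 1#))

  -- The smallest subfield of K containing ζ.  In characteristic zero the
  -- prime field is ℚ, so this is the field ℚ(ζ).
  data ℚ⟮_⟯ (ζ : Carrier) : Pred Carrier (f ⊔ ℓ₁) where
    ζ∈   : ℚ⟮ ζ ⟯ ζ
    0∈   : ℚ⟮ ζ ⟯ 0#
    1∈   : ℚ⟮ ζ ⟯ 1#
    +∈   : ∀ {x y} → ℚ⟮ ζ ⟯ x → ℚ⟮ ζ ⟯ y → ℚ⟮ ζ ⟯ (x + y)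
    *∈   : ∀ {x y} → ℚ⟮ ζ ⟯ x → ℚ⟮ ζ ⟯ y → ℚ⟮ ζ ⟯ (x * y)
    -∈   : ∀ {x} → ℚ⟮ ζ ⟯ x → ℚ⟮ ζ ⟯ (- x)
    inv∈ : ∀ {x y} → x * y ≈ 1# → ℚ⟮ ζ ⟯ x → ℚ⟮ ζ ⟯ y
    resp : ∀ {x y} → x ≈ y → ℚ⟮ ζ ⟯ x → ℚ⟮ ζ ⟯ y

{-# OPTIONS --safe #-}

-- Let q be a prime divisor of d.  The abelianization has an element of order q, so by
-- duality G has a surjective homomorphism to ℤ/q, that is, a nontrivial character χ with
-- values in the powers of ξ = ζ^(d/q).  Put S = Σ_{x ∈ D} χ(x) and S̄ = Σ_{x ∈ D} χ(x⁻¹).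
-- The partition of G gives S + S̄ = -1, the difference set property gives S S̄ = k - λ,
-- and the same two identities for the trivial character give v = 2k + 1 and k = 2λ + 1.
-- Hence (1 + 2S)² = 1 - 4 S S̄ = -v.
--
-- Constructively, the existence of χ is first shown under double negation, and χ is then
-- found by searching the finitely many maps G → ℤ/q; equality in K is stable because the
-- apartness of K is tight.
module Submission where

open import Defs
open import Algebra.Apartness.Bundles using (HeytingCommutativeRing; HeytingField)
open import Algebra.Bundles using (AbelianGroup; CommutativeRing; CommutativeSemiring; Group; Monoid)
import Algebra.Definitions.RawMonoid as RawMonoidDefs
import Algebra.Properties.AbelianGroup as AbelianGroupProperties
import Algebra.Properties.CommutativeMonoid.Mult as CommutativeMonoidMult
import Algebra.Properties.CommutativeMonoid.Sum as CommutativeMonoidSum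
import Algebra.Properties.Group as GroupProperties
import Algebra.Properties.Monoid.Mult as MonoidMult
import Algebra.Properties.Ring as RingProperties
import Algebra.Properties.Semiring.Exp as SemiringExp
import Algebra.Properties.Semiring.Mult as SemiringMult
import Algebra.Properties.Semiring.Sum as SemiringSum
import Algebra.Solver.CommutativeMonoid as CommutativeMonoidSolver
import Algebra.Solver.Ring.NaturalCoefficients.Default as SemiringSolver
open import Data.Fin.Base using (Fin; zero; suc; toℕ; fromℕ<; finToFun; funToFin)
import Data.Fin.Properties as Fin
open import Data.List.Base using (List; []; _∷_; tabulate)
open import Data.List.Relation.Unary.Any as Any using (Any; here; there)
open import Data.List.Relation.Unary.Any.Properties using (tabulate⁺)
open import Data.Nat.Base as ℕ
  using (ℕ; zero; suc; _∸_; _≤_; _<_; z<s; _!; NonZero; >-nonZero⁻¹; nonTrivial⇒n>1; n>1⇒nonTrivial)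
open import Data.Nat.Coprimality using (Coprime; coprime-Bézout)
open import Data.Nat.Divisibility
  using (_∣_; _∤_; _∣?_; divides; divides-refl; ∣-refl; ∣-trans; m∣m*n; m≤n⇒m!∣n!)
open import Data.Nat.DivMod
  using (_%_; _/_; m%n<n; m<n⇒m%n≡m; %-distribˡ-+; %-remove-+ʳ; m≡m%n+[m/n]*n)
open import Data.Nat.GCD using (module Bézout)
open import Data.Nat.Induction using (<-rec)
open import Data.Nat.Primality
  using (Prime; prime?; composite; ¬prime⇒composite; prime⇒irreducible; prime⇒nonZero; prime⇒nonTrivial)
import Data.Nat.Properties as ℕ
open import Data.Product.Base using (∃; ∃₂; _×_; _,_; proj₁; proj₂)
open import Data.Sum.Base using (_⊎_; inj₁; inj₂)
open import Function.Base using (_∘_)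
open import Function.Bundles using (Inverse)
import Function.Construct.Composition as Composition
import Function.Construct.Symmetry as Symmetry
open import Level using (Level; _⊔_)
open import Relation.Binary.Bundles using (Setoid)
open import Relation.Binary.PropositionalEquality.Core as ≡ using (_≡_)
open import Relation.Binary.PropositionalEquality.Properties using (module ≡-Reasoning)
import Relation.Binary.Reasoning.Setoid as SetoidReasoning
open import Relation.Nullary.Decidable.Core
  using (Dec; yes; no; _×-dec_; decidable-stable; map′; ¬¬-excluded-middle)
open import Relation.Nullary.Negation.Core using (¬_; contradiction)
open import Relation.Unary using (Pred; _∈_; Decidable)

private
  variable
    a ℓ c r i p p′ f ℓ₁ ℓ₂ : Level

-- Primes, and multiples of an element of a monoid.

1<prime : ∀ {q} → Prime q → 1 < q
1<prime {q} pr = nonTrivial⇒n>1 q {{prime⇒nonTrivial pr}}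

prime∤⇒coprime : ∀ {q n} → Prime q → q ∤ n → Coprime q n
prime∤⇒coprime pr q∤n (c∣q , c∣n) with prime⇒irreducible pr c∣q
... | inj₁ c≡1    = c≡1
... | inj₂ ≡.refl = contradiction c∣n q∤n

module _ (M : Monoid a ℓ) where
  open Monoid M
  open MonoidMult M renaming (_×_ to _·_)
  open SetoidReasoning setoid

  ·-ε : ∀ n {x} → x ≈ ε → n · x ≈ ε
  ·-ε zero    _   = refl
  ·-ε (suc n) x≈ε = trans (∙-cong x≈ε (·-ε n x≈ε)) (identityˡ ε)

  ∣⇒·≈ε : ∀ {m n x} → m ∣ n → m · x ≈ ε → n · x ≈ ε
  ∣⇒·≈ε {m} {x = x} (divides-refl k) mx≈ε =
    trans (sym (×-assocˡ x k m)) (·-ε k mx≈ε)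

  ·-% : ∀ {r x} .{{_ : NonZero r}} n → r · x ≈ ε → n · x ≈ (n % r) · x
  ·-% {r} {x} n rx≈ε = begin
    n · x                            ≈⟨ ×-congˡ (m≡m%n+[m/n]*n n r) ⟩
    (n % r ℕ.+ n / r ℕ.* r) · x      ≈⟨ ×-homo-+ x (n % r) _ ⟩
    (n % r) · x ∙ (n / r ℕ.* r) · x  ≈⟨ ∙-congˡ (∣⇒·≈ε (divides-refl (n / r)) rx≈ε) ⟩
    (n % r) · x ∙ ε                  ≈⟨ identityʳ _ ⟩
    (n % r) · x                      ∎

  -- Bézout writes 1 as the difference of a multiple of `m` and a multiple of `n`, both of which
  -- kill `x`. Over the naturals either multiple can be the larger one, hence the two cases.
  coprime⇒≈ε : ∀ {m n x} → Coprime m n → m · x ≈ ε → n · x ≈ ε → x ≈ ε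
  coprime⇒≈ε {m} {n} {x} c mx≈ε nx≈ε with coprime-Bézout c
  ... | Bézout.+- s t eq = begin
    x                    ≈⟨ identityʳ x ⟨
    x ∙ ε                ≈⟨ ∙-congˡ (∣⇒·≈ε (divides-refl t) nx≈ε) ⟨
    (1 ℕ.+ t ℕ.* n) · x  ≈⟨ ×-congˡ eq ⟩
    (s ℕ.* m) · x        ≈⟨ ∣⇒·≈ε (divides-refl s) mx≈ε ⟩
    ε                    ∎
  ... | Bézout.-+ s t eq = begin
    x                    ≈⟨ identityʳ x ⟨
    x ∙ ε                ≈⟨ ∙-congˡ (∣⇒·≈ε (divides-refl s) mx≈ε) ⟨
    (1 ℕ.+ s ℕ.* m) · x  ≈⟨ ×-congˡ eq ⟩
    (t ℕ.* n) · x        ≈⟨ ∣⇒·≈ε (divides-refl t) nx≈ε ⟩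
    ε                    ∎

-- Characters of prime order, and their construction on a cyclic group.

module _ (G : Group a ℓ) where
  open Group G
  open MonoidMult monoid renaming (_×_ to _·_)
  open SetoidReasoning setoid

  prime-order⇒∣ : ∀ {q x n} → Prime q → q · x ≈ ε → ¬ (x ≈ ε) → n · x ≈ ε → q ∣ n
  prime-order⇒∣ {q} {n = n} pr qx≈ε x≉ε nx≈ε with q ∣? n
  ... | yes q∣n = q∣n
  ... | no  q∤n = contradiction (coprime⇒≈ε monoid (prime∤⇒coprime pr q∤n) qx≈ε nx≈ε) x≉ε

  ·-cancel : ∀ m k x → m · x ≈ (m ℕ.+ k) · x → k · x ≈ ε
  ·-cancel m k x eq = GroupProperties.∙-cancelˡ G (m · x) (k · x) ε (begin
    m · x ∙ k · x  ≈⟨ ×-homo-+ x m k ⟨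
    (m ℕ.+ k) · x  ≈⟨ eq ⟨
    m · x          ≈⟨ identityʳ (m · x) ⟨
    m · x ∙ ε      ∎)

  ·-⁻¹ : ∀ {n x} → 0 < n → n · x ≈ ε → x ⁻¹ ≈ (n ∸ 1) · x
  ·-⁻¹ {x = x} 0<n nx≈ε = sym (GroupProperties.inverseʳ-unique G x _
    (trans (×-congˡ (ℕ.m+[n∸m]≡n 0<n)) nx≈ε))

  -- A homomorphism to ℤ/q with 1 in its image, as a map to the least residues.
  record Character (q : ℕ) .{{_ : NonZero q}} : Set (a ⊔ ℓ) where
    field
      residue  : Carrier → ℕ
      cong     : ∀ {x y} → x ≈ y → residue x ≡ residue y
      ε-homo   : residue ε ≡ 0
      homo     : ∀ x y → residue (x ∙ y) ≡ (residue x ℕ.+ residue y) % q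
      attains1 : ∃ λ x → residue x ≡ 1

  module _ {q} (pr : Prime q) {g} (qg≈ε : q · g ≈ ε) (g≉ε : ¬ (g ≈ ε)) where
    private instance
      q≢0 : NonZero q
      q≢0 = prime⇒nonZero pr

    ·-injective-% : ∀ m n → m · g ≈ n · g → m % q ≡ n % q
    ·-injective-% m n eq with ℕ.≤-total m n
    ... | inj₁ m≤n = ≡.sym (≤-case m≤n eq)
      where
      ≤-case : ∀ {m n} → m ≤ n → m · g ≈ n · g → n % q ≡ m % q
      ≤-case {m} m≤n eq with k , ≡.refl ← ℕ.m≤n⇒∃[o]m+o≡n m≤n =
        %-remove-+ʳ m (prime-order⇒∣ pr qg≈ε g≉ε (·-cancel m k g eq))
    ... | inj₂ n≤m with k , ≡.refl ← ℕ.m≤n⇒∃[o]m+o≡n n≤m =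
        %-remove-+ʳ n (prime-order⇒∣ pr qg≈ε g≉ε (·-cancel n k g (sym eq)))

    -- The residue is the discrete logarithm to base `g`, which is well defined modulo `q` because
    -- `g` has order exactly `q`.
    cyclic-character : (∀ x → ∃ λ n → x ≈ n · g) → Character q
    cyclic-character log = record
      { residue  = residue
      ; cong     = λ {x} {y} x≈y → residue-unique (trans x≈y (spec y))
      ; ε-homo   = ≡.trans (residue-unique {n = 0} refl) (m<n⇒m%n≡m (>-nonZero⁻¹ q))
      ; homo     = λ x y → ≡.trans
          (residue-unique (trans (∙-cong (spec x) (spec y)) (sym (×-homo-+ g (index x) (index y)))))
          (%-distribˡ-+ (index x) (index y) q)
      ; attains1 = g , ≡.trans (residue-unique (sym (×-homo-1 g))) (m<n⇒m%n≡m (1<prime pr))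
      }
      where
      index : Carrier → ℕ
      index x = let n , _ = log x in n
      spec : ∀ x → x ≈ index x · g
      spec x = let _ , p = log x in p
      residue : Carrier → ℕ
      residue x = index x % q
      residue-unique : ∀ {x n} → x ≈ n · g → residue x ≡ n % q
      residue-unique {x} {n} x≈ = ·-injective-% (index x) n (trans (sym (spec x)) x≈)

-- Multiples computed in a group and in a quotient on the same carrier agree, but not
-- definitionally, as the definition of multiples mentions the whole raw monoid.
×-cast : ∀ {C : Set a} (_∙_ : C → C → C) (ε : C)
  {_≈_ : C → C → Set ℓ₁} {_≈′_ : C → C → Set ℓ₂} →
  let M = record { _≈_ = _≈_ ; _∙_ = _∙_ ; ε = ε } ; M′ = record { _≈_ = _≈′_ ; _∙_ = _∙_ ; ε = ε } in
  ∀ n x → RawMonoidDefs._×_ M n x ≡ RawMonoidDefs._×_ M′ n x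
×-cast _∙_ ε zero    x = ≡.refl
×-cast _∙_ ε (suc n) x = ≡.cong (x ∙_) (×-cast _∙_ ε n x)

-- Quotients of abelian groups.

module _ (A : AbelianGroup a ℓ) where
  open AbelianGroup A
  open CommutativeMonoidSolver commutativeMonoid using (solve; _⊜_) renaming (_⊕_ to _:∙_)
  open AbelianGroupProperties A using (⁻¹-∙-comm)
  open SetoidReasoning setoid

  -- The quotient by the image of ι is formed by cancelling factors from that image, so the
  -- image only has to be closed under products.
  module _ {I : Set i} (ι : I → Carrier) (i₀ : I) (_⊕_ : I → I → I)
           (ι-homo : ∀ j k → ι (j ⊕ k) ≈ ι j ∙ ι k) where

    _≈ᴵ_ : Carrier → Carrier → Set (i ⊔ ℓ)
    x ≈ᴵ y = ∃₂ λ j k → x ∙ ι j ≈ y ∙ ι k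

    ≈⇒≈ᴵ : ∀ {x y} → x ≈ y → x ≈ᴵ y
    ≈⇒≈ᴵ x≈y = i₀ , i₀ , ∙-congʳ x≈y

    quotientByImage : AbelianGroup a (i ⊔ ℓ)
    quotientByImage = record
      { _≈_ = _≈ᴵ_
      ; _∙_ = _∙_
      ; ε   = ε
      ; _⁻¹ = _⁻¹
      ; isAbelianGroup = record
        { isGroup = record
          { isMonoid = record
            { isSemigroup = record
              { isMagma = record
                { isEquivalence = record
                  { refl  = ≈⇒≈ᴵ refl
                  ; sym   = λ (j , k , eq) → k , j , sym eq
                  ; trans = λ {x} {y} {z} → ≈ᴵ-trans x y z
                  }
                ; ∙-cong = λ {x} {y} {u} {v} → ≈ᴵ-∙-cong x y u v
                }
              ; assoc = λ x y z → ≈⇒≈ᴵ (assoc x y z)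
              }
            ; identity = (λ x → ≈⇒≈ᴵ (identityˡ x)) , (λ x → ≈⇒≈ᴵ (identityʳ x))
            }
          ; inverse = (λ x → ≈⇒≈ᴵ (inverseˡ x)) , (λ x → ≈⇒≈ᴵ (inverseʳ x))
          ; ⁻¹-cong = λ {x} {y} → ≈ᴵ-⁻¹-cong x y
          }
        ; comm = λ x y → ≈⇒≈ᴵ (comm x y)
        }
      }
      where
      ≈ᴵ-trans : ∀ x y z → x ≈ᴵ y → y ≈ᴵ z → x ≈ᴵ z
      ≈ᴵ-trans x y z (j , k , p) (m , n , r) = (j ⊕ m) , (n ⊕ k) , (begin
        x ∙ ι (j ⊕ m)      ≈⟨ ∙-congˡ (ι-homo j m) ⟩
        x ∙ (ι j ∙ ι m)    ≈⟨ assoc x _ _ ⟨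
        x ∙ ι j ∙ ι m      ≈⟨ ∙-congʳ p ⟩
        y ∙ ι k ∙ ι m      ≈⟨ solve 3 (λ s t u → (s :∙ t) :∙ u ⊜ (s :∙ u) :∙ t) refl y (ι k) (ι m) ⟩
        y ∙ ι m ∙ ι k      ≈⟨ ∙-congʳ r ⟩
        z ∙ ι n ∙ ι k      ≈⟨ assoc z _ _ ⟩
        z ∙ (ι n ∙ ι k)    ≈⟨ ∙-congˡ (ι-homo n k) ⟨
        z ∙ ι (n ⊕ k)      ∎)

      merge : ∀ x u j m → x ∙ u ∙ ι (j ⊕ m) ≈ (x ∙ ι j) ∙ (u ∙ ι m)
      merge x u j m = trans (∙-congˡ (ι-homo j m))
        (solve 4 (λ s t v w → (s :∙ t) :∙ (v :∙ w) ⊜ (s :∙ v) :∙ (t :∙ w)) refl x u (ι j) (ι m))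

      ≈ᴵ-∙-cong : ∀ x y u v → x ≈ᴵ y → u ≈ᴵ v → (x ∙ u) ≈ᴵ (y ∙ v)
      ≈ᴵ-∙-cong x y u v (j , k , p) (m , n , r) = (j ⊕ m) , (k ⊕ n) , (begin
        x ∙ u ∙ ι (j ⊕ m)      ≈⟨ merge x u j m ⟩
        (x ∙ ι j) ∙ (u ∙ ι m)  ≈⟨ ∙-cong p r ⟩
        (y ∙ ι k) ∙ (v ∙ ι n)  ≈⟨ merge y v k n ⟨
        y ∙ v ∙ ι (k ⊕ n)      ∎)

      undo : ∀ x w z → (x ∙ w) ⁻¹ ∙ (w ∙ z) ≈ x ⁻¹ ∙ z
      undo x w z = begin
        (x ∙ w) ⁻¹ ∙ (w ∙ z)     ≈⟨ ∙-congʳ (⁻¹-∙-comm x w) ⟨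
        x ⁻¹ ∙ w ⁻¹ ∙ (w ∙ z)    ≈⟨ assoc _ _ _ ⟩
        x ⁻¹ ∙ (w ⁻¹ ∙ (w ∙ z))  ≈⟨ ∙-congˡ (GroupProperties.\\-leftDividesʳ group w z) ⟩
        x ⁻¹ ∙ z                 ∎

      ≈ᴵ-⁻¹-cong : ∀ x y → x ≈ᴵ y → (x ⁻¹) ≈ᴵ (y ⁻¹)
      ≈ᴵ-⁻¹-cong x y (j , k , p) = k , j , (begin
        x ⁻¹ ∙ ι k                 ≈⟨ undo x (ι j) (ι k) ⟨
        (x ∙ ι j) ⁻¹ ∙ (ι j ∙ ι k) ≈⟨ ∙-cong (⁻¹-cong p) (comm _ _) ⟩
        (y ∙ ι k) ⁻¹ ∙ (ι k ∙ ι j) ≈⟨ undo y (ι k) (ι j) ⟩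
        y ⁻¹ ∙ ι j                 ∎)

    ·-quotient : ∀ n {x z} → x ≈ RawMonoidDefs._×_ rawMonoid n z →
      x ≈ᴵ RawMonoidDefs._×_ (AbelianGroup.rawMonoid quotientByImage) n z
    ·-quotient n {x} {z} p = ≡.subst (x ≈ᴵ_) (×-cast _∙_ ε n z) (≈⇒≈ᴵ p)

    quotient-≈ε : ∀ {x} → x ≈ᴵ ε → ∃₂ λ j k → x ≈ ι k ∙ ι j ⁻¹
    quotient-≈ε {x} (j , k , p) = j , k , (begin
      x                 ≈⟨ GroupProperties.//-rightDividesʳ group (ι j) x ⟨
      x ∙ ι j ∙ ι j ⁻¹  ≈⟨ ∙-congʳ (trans p (identityˡ _)) ⟩
      ι k ∙ ι j ⁻¹      ∎)

    quotient-character : ∀ {q} .{{_ : NonZero q}} →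
      Character (AbelianGroup.group quotientByImage) q → Character group q
    quotient-character χ = record
      { residue = residue ; cong = cong ∘ ≈⇒≈ᴵ ; ε-homo = ε-homo ; homo = homo ; attains1 = attains1 }
      where open Character χ

-- Existence of characters on abelian groups, up to double negation.

module _ {q} (pr : Prime q) where
  private instance
    q≢0 : NonZero q
    q≢0 = prime⇒nonZero pr

  module _ (A : AbelianGroup a ℓ) where
    open AbelianGroup A
    open MonoidMult monoid renaming (_×_ to _·_)
    open SetoidReasoning setoid

    -- In exponent q a nontrivial power of x generates the subgroup of x.
    ·-invert : ∀ {x g n} → q · x ≈ ε → ¬ (g ≈ ε) → g ≈ n · x → ∃ λ m → x ≈ m · g
    ·-invert {x} {g} {n} qx≈ε g≉ε g≈nx with q ∣? n
    ... | yes q∣n = contradiction (trans g≈nx (∣⇒·≈ε monoid q∣n qx≈ε)) g≉ε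
    ... | no  q∤n with coprime-Bézout (prime∤⇒coprime pr q∤n)
    ...   | Bézout.-+ s t eq = t , (begin
      x                    ≈⟨ identityʳ x ⟨
      x ∙ ε                ≈⟨ ∙-congˡ (∣⇒·≈ε monoid (divides-refl s) qx≈ε) ⟨
      (1 ℕ.+ s ℕ.* q) · x  ≈⟨ ×-congˡ eq ⟩
      (t ℕ.* n) · x        ≈⟨ ×-assocˡ x t n ⟨
      t · (n · x)          ≈⟨ ×-congʳ t g≈nx ⟨
      t · g                ∎)
    -- Here 1 + t n = s q, so `x` is the inverse of t g; the factor q - 1 turns this inverse into a
    -- multiple of `g`.
    ...   | Bézout.+- s t eq = (q ∸ 1) ℕ.* t , (begin
      x                 ≈⟨ GroupProperties.inverseˡ-unique group x _ (begin
        x ∙ (t · g)          ≈⟨ ∙-congˡ (×-congʳ t g≈nx) ⟩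
        x ∙ (t · (n · x))    ≈⟨ ∙-congˡ (×-assocˡ x t n) ⟩
        (1 ℕ.+ t ℕ.* n) · x  ≈⟨ ×-congˡ eq ⟩
        (s ℕ.* q) · x        ≈⟨ ∣⇒·≈ε monoid (divides-refl s) qx≈ε ⟩
        ε                    ∎) ⟩
      (t · g) ⁻¹           ≈⟨ ·-⁻¹ group (>-nonZero⁻¹ q) q[tg]≈ε ⟩
      (q ∸ 1) · (t · g)    ≈⟨ ×-assocˡ g (q ∸ 1) t ⟩
      ((q ∸ 1) ℕ.* t) · g  ∎)
      where
      q∣qtn : q ∣ q ℕ.* t ℕ.* n
      q∣qtn = divides (t ℕ.* n) (≡.trans (ℕ.*-assoc q t n) (ℕ.*-comm q (t ℕ.* n)))
      q[tg]≈ε : q · (t · g) ≈ ε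
      q[tg]≈ε = begin
        q · (t · g)          ≈⟨ ×-assocˡ g q t ⟩
        (q ℕ.* t) · g        ≈⟨ ×-congʳ (q ℕ.* t) g≈nx ⟩
        (q ℕ.* t) · (n · x)  ≈⟨ ×-assocˡ x (q ℕ.* t) n ⟩
        (q ℕ.* t ℕ.* n) · x  ≈⟨ ∣⇒·≈ε monoid q∣qtn qx≈ε ⟩
        ε                    ∎

  -- Each listed element x is either a power of g or has g outside its subgroup;
  -- in the latter case x is killed.  In the end g generates.
  exponent-q-character :
    (A : AbelianGroup a ℓ) →
    let open AbelianGroup A in
    let open MonoidMult monoid renaming (_×_ to _·_) in
    (∀ x → q · x ≈ ε) → ∀ g → ¬ (g ≈ ε) →
    (xs : List Carrier) → (∀ x → Any (x ≈_) xs ⊎ ∃ λ n → x ≈ n · g) →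
    ¬ ¬ Character group q
  exponent-q-character A exponent g g≉ε [] cover ¬χ =
    ¬χ (cyclic-character group pr (exponent g) g≉ε log)
    where
    open AbelianGroup A
    open MonoidMult monoid renaming (_×_ to _·_)
    log : ∀ x → ∃ λ n → x ≈ n · g
    log x with cover x
    ... | inj₂ p = p
  exponent-q-character {ℓ = ℓ} A exponent g g≉ε (x ∷ xs) cover ¬χ =
    -- The goal is a negation, so the case distinction on whether `g` lies in the subgroup of `x` is
    -- available without a decision procedure.
    ¬¬-excluded-middle {A = ∃ λ n → g ≈ n · x} λ where
      (yes (n , g≈nx)) → exponent-q-character A exponent g g≉ε xs
        (λ y → shrink (·-invert A {n = n} (exponent x) g≉ε g≈nx) (cover y)) ¬χ
      (no g∉⟨x⟩) → exponent-q-character A/x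
        (λ y → A/x.sym (·-quotient A ι 0 ℕ._+_ ι-homo q (sym (exponent y)))) g
        (λ g≈ε → g∉⟨x⟩ (in-⟨x⟩ (quotient-≈ε A ι 0 ℕ._+_ ι-homo g≈ε))) xs
        (λ y → coarsen (cover y)) (¬χ ∘ quotient-character A ι 0 ℕ._+_ ι-homo)
    where
    open AbelianGroup A
    open MonoidMult monoid renaming (_×_ to _·_)
    open SetoidReasoning setoid
    ι : ℕ → Carrier
    ι n = n · x
    ι-homo : ∀ j k → ι (j ℕ.+ k) ≈ ι j ∙ ι k
    ι-homo = ×-homo-+ x
    A/x : AbelianGroup _ ℓ
    A/x = quotientByImage A ι 0 ℕ._+_ ι-homo
    module A/x = AbelianGroup A/x
    open RawMonoidDefs A/x.rawMonoid renaming (_×_ to _·ˣ_) using ()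
    ≈⇒≈ˣ : ∀ {y z} → y ≈ z → y A/x.≈ z
    ≈⇒≈ˣ = ≈⇒≈ᴵ A ι 0 ℕ._+_ ι-homo

    shrink : ∀ {y} → (∃ λ m → x ≈ m · g) →
             Any (y ≈_) (x ∷ xs) ⊎ (∃ λ n → y ≈ n · g) → Any (y ≈_) xs ⊎ (∃ λ n → y ≈ n · g)
    shrink (m , x≈mg) (inj₁ (here y≈x))  = inj₂ (m , trans y≈x x≈mg)
    shrink _          (inj₁ (there p))   = inj₁ p
    shrink _          (inj₂ p)           = inj₂ p

    x≈ˣε : x A/x.≈ ε
    -- The witnesses encode x + 0 x = 0 + 1 x.
    x≈ˣε = 0 , 1 , trans (identityʳ x) (sym (trans (identityˡ _) (×-homo-1 x)))

    coarsen : ∀ {y} → Any (y ≈_) (x ∷ xs) ⊎ (∃ λ n → y ≈ n · g) →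
              Any (y A/x.≈_) xs ⊎ (∃ λ n → y A/x.≈ n ·ˣ g)
    coarsen (inj₁ (here y≈x)) = inj₂ (0 , A/x.trans (≈⇒≈ˣ y≈x) x≈ˣε)
    coarsen (inj₁ (there p))  = inj₁ (Any.map ≈⇒≈ˣ p)
    coarsen (inj₂ (n , p))    = inj₂ (n , ·-quotient A ι 0 ℕ._+_ ι-homo n p)

    in-⟨x⟩ : (∃₂ λ j k → g ≈ ι k ∙ ι j ⁻¹) → ∃ λ n → g ≈ n · x
    in-⟨x⟩ (j , k , p) = k ℕ.+ (q ∸ 1) ℕ.* j , (begin
      g                            ≈⟨ p ⟩
      k · x ∙ (j · x) ⁻¹           ≈⟨ ∙-congˡ (·-⁻¹ group (>-nonZero⁻¹ q) (exponent (j · x))) ⟩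
      k · x ∙ (q ∸ 1) · (j · x)    ≈⟨ ∙-congˡ (×-assocˡ x (q ∸ 1) j) ⟩
      k · x ∙ ((q ∸ 1) ℕ.* j) · x  ≈⟨ ×-homo-+ x k _ ⟨
      (k ℕ.+ (q ∸ 1) ℕ.* j) · x    ∎)

  module _ (A : AbelianGroup a ℓ) where
    open AbelianGroup A
    open MonoidMult monoid renaming (_×_ to _·_)
    open CommutativeMonoidMult commutativeMonoid using (×-distrib-+)

    -- If every element is a q-th power, factors q can be removed from an exponent of
    -- the group one at a time, and an exponent prime to q leaves no element of order q.
    q-divisible⇒no-order-q : (∀ x → ¬ ¬ ∃ λ y → x ≈ q · y) →
      ∀ n → 0 < n → (∀ x → ¬ ¬ (n · x ≈ ε)) → ∀ {h} → q · h ≈ ε → ¬ ¬ (h ≈ ε)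
    q-divisible⇒no-order-q divisible = <-rec _ step
      where
      NoOrderQ : ℕ → Set _
      NoOrderQ n = 0 < n → (∀ x → ¬ ¬ (n · x ≈ ε)) → ∀ {h} → q · h ≈ ε → ¬ ¬ (h ≈ ε)

      step : ∀ n → (∀ {m} → m < n → NoOrderQ m) → NoOrderQ n
      step n rec 0<n nx≈ε {h} qh≈ε h≉ε with q ∣? n
      ... | no q∤n = nx≈ε h λ nh≈ε → h≉ε (coprime⇒≈ε monoid (prime∤⇒coprime pr q∤n) qh≈ε nh≈ε)
      ... | yes (divides-refl m@(suc _)) = rec (ℕ.m<m*n m q (1<prime pr)) z<s
              (λ x mx≉ε → divisible x λ (y , x≈qy) → nx≈ε y λ [mq]y≈ε →
                mx≉ε (trans (×-congʳ m x≈qy) (trans (×-assocˡ y m q) [mq]y≈ε)))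
              qh≈ε h≉ε

    -- An element of order `q` prevents multiplication by `q` from being surjective, so, up to
    -- double negation, some `g` lies outside qA. In A/qA, which has exponent `q`, this `g` is
    -- nontrivial; a character of the quotient is then pulled back to A.
    abelian-character : ∀ n → 0 < n → (∀ x → n · x ≈ ε) →
      (xs : List Carrier) → (∀ x → Any (x ≈_) xs) →
      ∀ {h} → q · h ≈ ε → ¬ (h ≈ ε) → ¬ ¬ Character group q
    abelian-character n 0<n nx≈ε xs cover qh≈ε h≉ε ¬χ =
      q-divisible⇒no-order-q
        (λ g g∉qA → exponent-q-character A/q exponent g
          (λ g≈ε → let j , k , p = quotient-≈ε A (q ·_) ε _∙_ ·-homo g≈ε in
            g∉qA (k ∙ j ⁻¹ , trans p (trans (∙-congˡ (q·⁻¹ j)) (sym (·-homo k (j ⁻¹))))))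
          xs (λ x → inj₁ (Any.map (≈⇒≈ᴵ A (q ·_) ε _∙_ ·-homo) (cover x)))
          (¬χ ∘ quotient-character A (q ·_) ε _∙_ ·-homo))
        n 0<n (λ x k → k (nx≈ε x)) qh≈ε h≉ε
      where
      ·-homo : ∀ x y → q · (x ∙ y) ≈ q · x ∙ q · y
      ·-homo x y = ×-distrib-+ x y q
      q·⁻¹ : ∀ x → (q · x) ⁻¹ ≈ q · (x ⁻¹)
      q·⁻¹ x = sym (GroupProperties.inverseʳ-unique group (q · x) (q · (x ⁻¹))
        (trans (sym (·-homo x (x ⁻¹))) (·-ε monoid q (inverseʳ x))))
      A/q : AbelianGroup _ _
      A/q = quotientByImage A (q ·_) ε _∙_ ·-homo
      module A/q = AbelianGroup A/q
      open RawMonoidDefs A/q.rawMonoid renaming (_×_ to _·q_) using ()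
      exponent : ∀ x → (q ·q x) A/q.≈ ε
      exponent x = A/q.trans (A/q.sym (·-quotient A (q ·_) ε _∙_ ·-homo q refl))
        (ε , x , trans (∙-congˡ (·-ε monoid q refl)) (comm _ _))

-- Prime divisors, and orders of elements in finite groups.

prime-divisor : ∀ n → 1 < n → ∃ λ q → Prime q × q ∣ n
prime-divisor = <-rec _ step
  where
  step : ∀ n → (∀ {m} → m < n → 1 < m → ∃ λ q → Prime q × q ∣ m) → 1 < n → ∃ λ q → Prime q × q ∣ n
  step n rec 1<n with prime? n
  ... | yes pr = n , pr , ∣-refl
  ... | no ¬pr with composite {d} d<n d∣n ← ¬prime⇒composite {{n>1⇒nonTrivial 1<n}} ¬pr
               with q , pr , q∣d ← rec d<n (nonTrivial⇒n>1 d) = q , pr , ∣-trans q∣d d∣n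

module _ {S : Setoid a ℓ} {n} (e : HasCardinality S n) where
  open Setoid S
  open Inverse e

  to-injective : ∀ {x y} → to x ≡ to y → x ≈ y
  to-injective eq = trans (sym (strictlyInverseʳ _)) (inverseʳ eq)

  from-injective : ∀ {i j} → from i ≈ from j → i ≡ j
  from-injective eq = ≡.trans (≡.sym (strictlyInverseˡ _)) (inverseˡ eq)

module _ (H : Group a ℓ) where
  open Group H
  open MonoidMult monoid renaming (_×_ to _·_)

  -- Two of the n + 1 multiples 0 x, ..., n x share a label, and the difference of their indices
  -- kills `x`. The labelling is abstract because it comes from an enumeration of the whole group in
  -- one use and of a cyclic subgroup in the other.
  pigeonhole-torsion : ∀ {n x} (f : ℕ → Fin n) → (∀ {i j} → f i ≡ f j → i · x ≈ j · x) →
    ∃ λ r → 0 < r × r ≤ n × r · x ≈ ε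
  pigeonhole-torsion {n} {x} f f-inj
    with i , j , i<j , fi≡fj ← Fin.pigeonhole (ℕ.n<1+n n) (f ∘ toℕ) =
    toℕ j ∸ toℕ i , ℕ.m<n⇒0<n∸m i<j ,
    ℕ.≤-trans (ℕ.m∸n≤m (toℕ j) (toℕ i)) (ℕ.≤-pred (Fin.toℕ<n j)) ,
    ·-cancel H (toℕ i) _ x (trans (f-inj fi≡fj) (×-congˡ (≡.sym (ℕ.m+[n∸m]≡n (ℕ.<⇒≤ i<j)))))

  -- Each element is killed by some positive r at most `n`, and r divides `n !`. This crude common
  -- exponent takes the place of Lagrange's theorem.
  finite-exponent : ∀ {n} → HasCardinality setoid n → ∀ x → (n !) · x ≈ ε
  finite-exponent {n} e x
    with r@(suc _) , 0<r , r≤n , rx≈ε ← pigeonhole-torsion {n} {x} (λ i → Inverse.to e (i · x)) (to-injective e) =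
    ∣⇒·≈ε monoid {m = r} (∣-trans (m∣m*n _) (m≤n⇒m!∣n! r≤n)) rx≈ε

  module _ (g : Carrier) where
    ·∈⟨g⟩ : ∀ n → Generated H (_≈ g) (n · g)
    ·∈⟨g⟩ zero    = ε∈
    ·∈⟨g⟩ (suc n) = ∙∈ (gen refl) (·∈⟨g⟩ n)

    -- Inverses are natural multiples because `r` kills the whole subgroup: the inverse of x is (r -
    -- 1) x.
    ⟨g⟩⇒· : ∀ {r} → 0 < r → r · g ≈ ε → ∀ {x} → Generated H (_≈ g) x → ∃ λ n → x ≈ n · g
    ⟨g⟩⇒· 0<r rg≈ε (gen x≈g) = 1 , trans x≈g (sym (×-homo-1 g))
    ⟨g⟩⇒· 0<r rg≈ε ε∈        = 0 , refl
    ⟨g⟩⇒· 0<r rg≈ε (∙∈ p q) with m , x≈ ← ⟨g⟩⇒· 0<r rg≈ε p | n , y≈ ← ⟨g⟩⇒· 0<r rg≈ε q =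
      m ℕ.+ n , trans (∙-cong x≈ y≈) (sym (×-homo-+ g m n))
    ⟨g⟩⇒· {r} 0<r rg≈ε (⁻¹∈ {x} p) with n , x≈ ← ⟨g⟩⇒· 0<r rg≈ε p =
      (r ∸ 1) ℕ.* n , trans (·-⁻¹ H 0<r rx≈ε) (trans (×-congʳ (r ∸ 1) x≈) (×-assocˡ g (r ∸ 1) n))
      where
      rx≈ε : r · x ≈ ε
      rx≈ε = trans (×-congʳ r x≈) (trans (×-assocˡ g r n) (∣⇒·≈ε monoid {m = r} (m∣m*n n) rg≈ε))
    ⟨g⟩⇒· 0<r rg≈ε (resp x≈y p) with n , x≈ ← ⟨g⟩⇒· 0<r rg≈ε p = n , trans (sym x≈y) x≈

    module _ {d} (e : HasCardinality (subsetoid setoid (Generated H (_≈ g))) d) where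
      open Inverse e using (to; from; strictlyInverseʳ)

      -- Every element of the subgroup is one of 0 g, ..., (r - 1) g, so reducing logarithms modulo
      -- `r` injects `Fin d` into `Fin r`.
      order-≤ : ∀ {r} → 0 < r → r · g ≈ ε → d ≤ r
      order-≤ {r@(suc _)} 0<r rg≈ε = Fin.injective⇒≤ {f = λ k → fromℕ< (m%n<n (index k) r)} λ {j} {k} eq →
        from-injective e (trans (spec j) (trans (×-congˡ (residues-≡ eq)) (sym (spec k))))
        where
        index : Fin d → ℕ
        index k = proj₁ (⟨g⟩⇒· 0<r rg≈ε (proj₂ (from k)))
        spec : ∀ k → proj₁ (from k) ≈ (index k % r) · g
        spec k = trans (proj₂ (⟨g⟩⇒· 0<r rg≈ε (proj₂ (from k)))) (·-% monoid (index k) rg≈ε)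
        residues-≡ : ∀ {j k} → fromℕ< (m%n<n (index j) r) ≡ fromℕ< (m%n<n (index k) r) →
                     index j % r ≡ index k % r
        residues-≡ {j} {k} eq = Fin.fromℕ<-injective _ _ (m%n<n (index j) r) (m%n<n (index k) r) eq

      -- The pigeonhole principle yields a positive exponent r at most `d`, and `order-≤` forces r =
      -- d.
      order-≈ε : d · g ≈ ε
      order-≈ε with r , 0<r , r≤d , rg≈ε ← pigeonhole-torsion (λ n → to (n · g , ·∈⟨g⟩ n)) (to-injective e) =
        trans (×-congˡ (ℕ.≤-antisym (order-≤ 0<r rg≈ε) r≤d)) rg≈ε

      -- The witness is (d/q) g: by `order-≤` no positive number below `d` kills `g`.
      prime-order-element : ∀ {q} → Prime q → q ∣ d → 0 < d → ∃ λ h → q · h ≈ ε × ¬ (h ≈ ε)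
      prime-order-element {q} pr (divides (suc m) eq) 0<d = suc m · g ,
        trans (×-assocˡ g q (suc m)) (trans (×-congˡ (≡.trans (ℕ.*-comm q (suc m)) (≡.sym eq))) order-≈ε) ,
        λ p → ℕ.<⇒≱ (≡.subst (suc m <_) (≡.sym eq) (ℕ.m<m*n (suc m) q (1<prime pr))) (order-≤ z<s p)
      prime-order-element pr (divides zero eq) 0<d = contradiction (≡.sym eq) (ℕ.<⇒≢ 0<d)

-- Finite search for a character.

module _ (G : Group a ℓ) {v} (e : HasCardinality (Group.setoid G) v) {q} .{{q≢0 : NonZero q}} where
  open Group G
  open Inverse e

  -- Storing the values along the enumeration of G makes the conditions on a character decidable and
  -- the candidates finite in number.
  IsResidueTable : (Fin v → Fin q) → Set
  IsResidueTable c = toℕ (c (to ε)) ≡ 0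
    × (∀ i j → toℕ (c (to (from i ∙ from j))) ≡ (toℕ (c i) ℕ.+ toℕ (c j)) % q)
    × ∃ λ i → toℕ (c i) ≡ 1

  isResidueTable? : ∀ c → Dec (IsResidueTable c)
  isResidueTable? c = (toℕ (c (to ε)) ℕ.≟ 0)
    ×-dec Fin.all? (λ i → Fin.all? λ j → toℕ (c (to (from i ∙ from j))) ℕ.≟ (toℕ (c i) ℕ.+ toℕ (c j)) % q)
    ×-dec Fin.any? (λ i → toℕ (c i) ℕ.≟ 1)

  table⇒character : ∀ c → IsResidueTable c → Character G q
  table⇒character c (zero′ , homo , k , one) = record
    { residue  = λ x → toℕ (c (to x))
    ; cong     = λ x≈y → ≡.cong (toℕ ∘ c) (to-cong x≈y)
    ; ε-homo   = zero′
    ; homo     = λ x y → ≡.trans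
        (≡.cong (toℕ ∘ c) (to-cong (∙-cong (sym (strictlyInverseʳ _)) (sym (strictlyInverseʳ _))))) (homo (to x) (to y))
    ; attains1 = from k , ≡.trans (≡.cong (toℕ ∘ c) (strictlyInverseˡ _)) one
    }

  character⇒table : Character G q → ∃ λ i → IsResidueTable (finToFun {q} {v} i)
  character⇒table χ = funToFin table ,
    ≡.trans (spec (to ε)) (≡.trans (cong (strictlyInverseʳ _)) ε-homo) ,
    (λ i j → begin
      toℕ (table′ (to (from i ∙ from j)))          ≡⟨ spec _ ⟩
      residue (from (to (from i ∙ from j)))        ≡⟨ cong (strictlyInverseʳ _) ⟩
      residue (from i ∙ from j)                    ≡⟨ homo _ _ ⟩
      (residue (from i) ℕ.+ residue (from j)) % q  ≡⟨ ≡.cong₂ (λ m n → (m ℕ.+ n) % q) (spec i) (spec j) ⟨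
      (toℕ (table′ i) ℕ.+ toℕ (table′ j)) % q      ∎) ,
    (let x , one = attains1 in to x , ≡.trans (spec (to x)) (≡.trans (cong (strictlyInverseʳ _)) one))
    where
    open Character χ
    open ≡-Reasoning
    -- The bound comes from `homo` at `x` and `ε`, which exhibits the residue as a remainder modulo
    -- `q`.
    residue<q : ∀ x → residue x < q
    residue<q x = ≡.subst (_< q) (≡.trans (≡.sym (homo x ε)) (cong (identityʳ x)))
      (m%n<n (residue x ℕ.+ residue ε) q)
    table : Fin v → Fin q
    table i = fromℕ< (residue<q (from i))
    -- Coding a function as a number and decoding it gives back `table` only pointwise, so the
    -- conditions are proved for the decoded function.
    table′ : Fin v → Fin q
    table′ = finToFun (funToFin table)
    spec : ∀ i → toℕ (table′ i) ≡ residue (from i)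
    spec i = ≡.trans (≡.cong toℕ (Fin.finToFun-funToFin table i)) (Fin.toℕ-fromℕ< (residue<q (from i)))

  -- Whether a finite group has a character is decided by exhaustive search.
  character-stable : ¬ ¬ Character G q → Character G q
  character-stable ¬¬χ = let i , p = decidable-stable (Fin.any? (isResidueTable? ∘ finToFun))
                                       (λ ¬p → ¬¬χ (¬p ∘ character⇒table))
                         in table⇒character (finToFun i) p

-- From the abelianization to the group.

module _ (G : Group a ℓ) where
  open Group G
  private module Gᵃᵇ = Group (abelianization G)

  ≈⇒≈ᵃᵇ : ∀ {x y} → x ≈ y → x Gᵃᵇ.≈ y
  ≈⇒≈ᵃᵇ x≈y = resp (sym (GroupProperties.x≈y⇒x∙y⁻¹≈ε G x≈y)) ε∈

  abelianizationᵃ : AbelianGroup a (a ⊔ ℓ)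
  abelianizationᵃ = record { isAbelianGroup = record { isGroup = Gᵃᵇ.isGroup ; comm = comm } }
    where
    comm : ∀ x y → (x ∙ y) Gᵃᵇ.≈ (y ∙ x)
    comm x y = gen (x , y , trans (∙-congˡ (GroupProperties.⁻¹-anti-homo-∙ G y x))
      (sym (assoc (x ∙ y) (x ⁻¹) (y ⁻¹))))

  -- An element of order `q` in the cyclic subgroup gives a character of the abelianization up to
  -- double negation. It is pulled back to G before the double negation is removed, since the search
  -- runs along the enumeration of G; in the quotient that enumeration is only a covering list,
  -- possibly with repetitions.
  abelianization-character : ∀ {v} → HasCardinality setoid v → ∀ {d} → 1 < d →
    HasCyclicSubgroupOfOrder (abelianization G) d →
    ∀ {q} (pr : Prime q) → q ∣ d → Character G q {{prime⇒nonZero pr}}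
  abelianization-character {v} e {d} 1<d (g , card) {q} pr q∣d
    with h , qh≈ε , h≉ε ← prime-order-element (abelianization G) g card pr q∣d (ℕ.<-trans z<s 1<d) =
    character-stable G e λ ¬χ → abelian-character pr abelianizationᵃ (v !) (ℕ.1≤n! v)
      (λ x → ≡.subst (Gᵃᵇ._≈ ε) (×-cast _∙_ ε (v !) x) (≈⇒≈ᵃᵇ (finite-exponent G e x)))
      (tabulate from) (λ x → tabulate⁺ (to x) (≈⇒≈ᵃᵇ (sym (strictlyInverseʳ _))))
      qh≈ε h≉ε (¬χ ∘ lower)
    where
    open Inverse e using (to; from; strictlyInverseʳ)
    instance
      q≢0 : NonZero q
      q≢0 = prime⇒nonZero pr
    lower : Character (abelianization G) q → Character G q
    lower χ = record
      { residue = residue ; cong = cong ∘ ≈⇒≈ᵃᵇ ; ε-homo = ε-homo ; homo = homo ; attains1 = attains1 }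
      where open Character χ

-- Finite sums in a commutative semiring.

module Sums (R : CommutativeSemiring c r) where
  open CommutativeSemiring R hiding (zero)
  open CommutativeMonoidSum +-commutativeMonoid using (∑-distrib-+; ∑-comm; sum-permute) public
  open SemiringSum semiring
    using (sum; sum-syntax; sum-cong-≋; sum-replicate; sum-replicate-zero; *-distribˡ-sum; *-distribʳ-sum) public

  open SemiringMult semiring using () renaming (_×_ to _·_)

  -- The Iverson bracket, which turns sums over a subset into sums over the whole group.
  [_] : {P : Set p} → Dec P → Carrier
  [ yes _ ] = 1#
  [ no  _ ] = 0#

  []-cong : {P : Set p} {Q : Set p′} → (P → Q) → (Q → P) →
    (P? : Dec P) (Q? : Dec Q) → [ P? ] ≈ [ Q? ]
  []-cong f g (yes _) (yes _)  = refl
  []-cong f g (yes p) (no ¬q)  = contradiction (f p) ¬q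
  []-cong f g (no ¬p) (yes q)  = contradiction (g q) ¬p
  []-cong f g (no _)  (no _)   = refl

  []-yes : {P : Set p} (P? : Dec P) → P → [ P? ] ≈ 1#
  []-yes (yes _) _ = refl
  []-yes (no ¬p) p = contradiction p ¬p

  []-no : {P : Set p} (P? : Dec P) → ¬ P → [ P? ] ≈ 0#
  []-no (yes p) ¬p = contradiction p ¬p
  []-no (no _)  _  = refl

  sum-≈0 : ∀ {n} {f : Fin n → Carrier} → (∀ i → f i ≈ 0#) → sum f ≈ 0#
  sum-≈0 {n} f≈0 = trans (sum-cong-≋ f≈0) (sum-replicate-zero n)

  sum-δ : ∀ {n} (i : Fin n) (f : Fin n → Carrier) → ∑[ j < n ] ([ i Fin.≟ j ] * f j) ≈ f i
  sum-δ zero    f = trans (+-cong (*-identityˡ _) (sum-≈0 λ j → zeroˡ (f (suc j)))) (+-identityʳ _)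
  sum-δ (suc i) f = trans (+-cong (zeroˡ _) (sum-cong-≋ λ j →
      *-congʳ ([]-cong Fin.suc-injective (≡.cong suc) (suc i Fin.≟ suc j) (i Fin.≟ j))))
    (trans (+-identityˡ _) (sum-δ i (f ∘ suc)))

  module Finite {S : Setoid a ℓ} {n} (e : HasCardinality S n) where
    private module S = Setoid S
    open Inverse e using (to; from; to-cong; from-cong; strictlyInverseˡ; strictlyInverseʳ)

    Congruent : (S.Carrier → Carrier) → Set (a ⊔ ℓ ⊔ r)
    Congruent F = ∀ {x y} → x S.≈ y → F x ≈ F y

    -- Opaque, so that a summand can be recovered from its sum by unification.
    opaque
      ∑ : (S.Carrier → Carrier) → Carrier
      ∑ F = ∑[ i < n ] F (from i)

      ∑-cong : ∀ {F H} → (∀ x → F x ≈ H x) → ∑ F ≈ ∑ H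
      ∑-cong F≈H = sum-cong-≋ (F≈H ∘ from)

      ∑-+ : ∀ {F H} → ∑ (λ x → F x + H x) ≈ ∑ F + ∑ H
      ∑-+ = ∑-distrib-+ {n} _ _

      ∑-*ˡ : ∀ {F} u → u * ∑ F ≈ ∑ (λ x → u * F x)
      ∑-*ˡ u = *-distribˡ-sum {n} u _

      ∑-*ʳ : ∀ {F} u → ∑ F * u ≈ ∑ (λ x → F x * u)
      ∑-*ʳ u = *-distribʳ-sum {n} u _

      ∑-swap : ∀ {F : S.Carrier → S.Carrier → Carrier} → ∑ (λ x → ∑ (F x)) ≈ ∑ (λ y → ∑ (λ x → F x y))
      ∑-swap {F} = ∑-comm (λ i j → F (from i) (from j))

      ∑-sum-swap : ∀ {m} {F : S.Carrier → Fin m → Carrier} →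
        ∑ (λ x → sum (F x)) ≈ ∑[ j < m ] ∑ (λ x → F x j)
      ∑-sum-swap {F = F} = ∑-comm (F ∘ from)

      ∑-1 : ∑ (λ _ → 1#) ≈ n · 1#
      ∑-1 = sum-replicate n

      ∑-∈ : {P : Pred Carrier p} → P 0# → (∀ {x y} → P x → P y → P (x + y)) →
        ∀ {F} → (∀ x → P (F x)) → P (∑ F)
      ∑-∈ {P = P} P0 P+ {F} PF = sum-∈ (F ∘ from) (PF ∘ from)
        where
        sum-∈ : ∀ {m} (f : Fin m → Carrier) → (∀ i → P (f i)) → P (sum f)
        sum-∈ {ℕ.zero}  f Pf = P0
        sum-∈ {ℕ.suc m} f Pf = P+ (Pf zero) (sum-∈ (f ∘ suc) (Pf ∘ suc))

    _≟_ : ∀ x y → Dec (x S.≈ y)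
    x ≟ y = map′ (to-injective e) to-cong (to x Fin.≟ to y)

    opaque
      unfolding ∑

      ∑-δ : ∀ {F} → Congruent F → ∀ x → ∑ (λ y → [ x ≟ y ] * F y) ≈ F x
      ∑-δ {F} F-cong x = begin
        ∑[ i < n ] ([ x ≟ from i ] * F (from i))      ≈⟨ sum-cong-≋ (λ i → *-congʳ ([]-cong
            (λ x≈ → ≡.trans (to-cong x≈) (strictlyInverseˡ i))
            (λ eq → S.trans (S.sym (strictlyInverseʳ x)) (from-cong eq))
            (x ≟ from i) (to x Fin.≟ i))) ⟩
        ∑[ i < n ] ([ to x Fin.≟ i ] * F (from i))    ≈⟨ sum-δ (to x) (F ∘ from) ⟩
        F (from (to x))                               ≈⟨ F-cong (strictlyInverseʳ x) ⟩
        F x                                           ∎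
        where open SetoidReasoning setoid

      ∑-reindex : ∀ {F} → Congruent F → (φ : Inverse S S) → ∑ F ≈ ∑ (F ∘ Inverse.to φ)
      ∑-reindex {F} F-cong φ = trans
        (sum-permute (F ∘ from) (Composition.inverse (Symmetry.inverse e) (Composition.inverse φ e)))
        (sum-cong-≋ {n} λ i → F-cong (strictlyInverseʳ (Inverse.to φ (from i))))

    ∑-[≟] : ∀ x → ∑ (λ y → [ x ≟ y ]) ≈ 1#
    ∑-[≟] x = trans (∑-cong λ y → sym (*-identityʳ _)) (∑-δ (λ _ → refl) x)

-- Translations and inversion as bijections.

module _ (G : Group a ℓ) where
  open Group G
  open GroupProperties G

  rightTranslation : Carrier → Inverse setoid setoid
  rightTranslation y = record
    { to = _∙ y ; from = _∙ y ⁻¹ ; to-cong = ∙-congʳ ; from-cong = ∙-congʳ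
    ; inverse = (λ eq → trans (∙-congʳ eq) (//-rightDividesˡ y _))
              , (λ eq → trans (∙-congʳ eq) (//-rightDividesʳ y _))
    }

  inversion : Inverse setoid setoid
  inversion = record
    { to = _⁻¹ ; from = _⁻¹ ; to-cong = ⁻¹-cong ; from-cong = ⁻¹-cong
    ; inverse = inv , inv
    }
    where
    inv : ∀ {x y} → y ≈ x ⁻¹ → y ⁻¹ ≈ x
    inv eq = trans (⁻¹-cong eq) (⁻¹-involutive _)

-- Counting identities of a skew-Hadamard difference set.

module SkewHadamard
  (G : Group a ℓ) {v : ℕ} (e : HasCardinality (Group.setoid G) v)
  {D : Pred (Group.Carrier G) p} (shds : IsSkewHadamardDifferenceSet G D)
  (R : CommutativeSemiring c r) where

  open CommutativeSemiring R
  open SetoidReasoning setoid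
  open SemiringSolver R using (solve; _:=_; _:+_; _:*_; con)
  private module G = Group G
  open G using (_∙_; ε; _⁻¹) renaming (_≈_ to _≈ᴳ_)
  open GroupProperties G
  open IsSkewHadamardDifferenceSet shds
  open Sums R public
  open Finite e public

  private
    l : ℕ
    l = let _ , l , _ = isDifferenceSet in l

    isDS : IsDifferenceSet G _ l D
    isDS = let _ , _ , ds = isDifferenceSet in ds

  open IsDifferenceSet isDS using (respects; representations)

  -- The parameter λ as a semiring element, in the form in which `count-λ` produces it.
  λ# : Carrier
  λ# = ∑[ m < l ] 1#

  -- `covers` acts as a decision procedure: it names one of three parts, and disjointness excludes
  -- `D` for the other two.
  D? : Decidable D
  D? x with covers x
  ... | inj₁ x∈D          = yes x∈D
  ... | inj₂ (inj₁ x∈D⁻¹) = no λ x∈D → D⊥D⁻¹ (x∈D , x∈D⁻¹)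
  ... | inj₂ (inj₂ x≈ε)   = no λ x∈D → D⊥ε (x∈D , x≈ε)

  𝟙 : G.Carrier → Carrier
  𝟙 x = [ D? x ]

  𝟙-cong : Congruent 𝟙
  𝟙-cong x≈y = []-cong (respects x≈y) (respects (G.sym x≈y)) (D? _) (D? _)

  κ : Carrier
  κ = ∑ 𝟙

  ∈⁻¹ : ∀ {x} → D (x ⁻¹) → InverseSet G D x
  ∈⁻¹ x⁻¹∈D = _ , x⁻¹∈D , G.sym (⁻¹-involutive _)

  partition : ∀ x → (𝟙 x + 𝟙 (x ⁻¹)) + [ ε ≟ x ] ≈ 1#
  partition x with covers x
  ... | inj₁ x∈D = begin
    (1# + 𝟙 (x ⁻¹)) + [ ε ≟ x ]
      ≈⟨ +-cong (+-congˡ ([]-no (D? _) λ x⁻¹∈D → D⊥D⁻¹ (x∈D , ∈⁻¹ x⁻¹∈D)))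
                ([]-no (ε ≟ x) λ ε≈x → D⊥ε (x∈D , G.sym ε≈x)) ⟩
    (1# + 0#) + 0#   ≈⟨ trans (+-identityʳ _) (+-identityʳ _) ⟩
    1#               ∎
  ... | inj₂ (inj₁ x∈D⁻¹@(y , y∈D , x≈y⁻¹)) = begin
    (0# + 𝟙 (x ⁻¹)) + [ ε ≟ x ]
      ≈⟨ +-cong (+-congˡ ([]-yes (D? _)
                  (respects (G.trans (G.sym (⁻¹-involutive y)) (G.⁻¹-cong (G.sym x≈y⁻¹))) y∈D)))
                ([]-no (ε ≟ x) λ ε≈x → D⁻¹⊥ε (x∈D⁻¹ , G.sym ε≈x)) ⟩
    (0# + 1#) + 0#   ≈⟨ trans (+-identityʳ _) (+-identityˡ _) ⟩
    1#               ∎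
  ... | inj₂ (inj₂ x≈ε) = begin
    (0# + 𝟙 (x ⁻¹)) + [ ε ≟ x ]
      ≈⟨ +-cong (+-congˡ ([]-no (D? _) λ x⁻¹∈D → D⊥ε (x⁻¹∈D , G.trans (G.⁻¹-cong x≈ε) ε⁻¹≈ε)))
                ([]-yes (ε ≟ x) (G.sym x≈ε)) ⟩
    (0# + 0#) + 1#   ≈⟨ trans (+-congʳ (+-identityʳ _)) (+-identityˡ _) ⟩
    1#               ∎

  -- The coefficient of `g` in the group ring product of D and its inverse set: `y` stands for d₂
  -- and `g ∙ y` for d₁.
  count : G.Carrier → Carrier
  count g = ∑ λ y → 𝟙 y * 𝟙 (g ∙ y)

  count-ε : ∀ {g} → g ≈ᴳ ε → count g ≈ κ
  count-ε {g} g≈ε = ∑-cong λ y → trans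
    (*-congˡ (𝟙-cong (G.trans (G.∙-congʳ g≈ε) (G.identityˡ y)))) (idem (D? y))
    where
    idem : ∀ {y} (d : Dec (D y)) → [ d ] * [ d ] ≈ [ d ]
    idem (yes _) = *-identityˡ 1#
    idem (no _)  = zeroˡ 0#

  -- A representation of `g` is determined by its second entry, so each summand counts the indices
  -- whose representation ends in `y`. After exchanging the sums every index contributes 1.
  count-λ : ∀ {g} → ¬ (g ≈ᴳ ε) → count g ≈ λ#
  count-λ {g} g≉ε = begin
    ∑ (λ y → 𝟙 y * 𝟙 (g ∙ y))                   ≈⟨ ∑-cong (λ y → pointwise y (D? y) (D? (g ∙ y))) ⟩
    ∑ (λ y → ∑[ m < l ] [ second m ≟ y ])       ≈⟨ ∑-sum-swap {m = l} ⟩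
    ∑[ m < l ] ∑ (λ y → [ second m ≟ y ])       ≈⟨ sum-cong-≋ (λ m → ∑-[≟] (second m)) ⟩
    λ#                                          ∎
    where
    module Rep = Inverse (representations g g≉ε)

    second : Fin l → G.Carrier
    second m = let (_ , d₂) , _ = Rep.from m in d₂

    first≈ : ∀ {d₁ d₂} → d₁ ∙ d₂ ⁻¹ ≈ᴳ g → d₁ ≈ᴳ g ∙ d₂
    first≈ eq = G.trans (G.sym (//-rightDividesˡ _ _)) (G.∙-congʳ eq)

    second∈ : ∀ {m y} → second m ≈ᴳ y → D y × D (g ∙ y)
    second∈ {m} eq = let _ , d₁∈D , d₂∈D , _ , d₁d₂⁻¹≈g = Rep.from m in
      respects eq d₂∈D , respects (G.trans (first≈ d₁d₂⁻¹≈g) (G.∙-congˡ eq)) d₁∈D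

    index : ∀ y → D y → D (g ∙ y) → Fin l
    index y y∈D gy∈D = Rep.to ((g ∙ y , y) , gy∈D , y∈D ,
      (λ gy≈y → g≉ε (identityˡ-unique g y gy≈y)) , //-rightDividesʳ y g)

    pointwise : ∀ y (d : Dec (D y)) (d′ : Dec (D (g ∙ y))) → [ d ] * [ d′ ] ≈ ∑[ m < l ] [ second m ≟ y ]
    pointwise y (yes y∈D) (yes gy∈D) = begin
      1# * 1#                               ≈⟨ *-identityˡ 1# ⟩
      1#                                    ≈⟨ sum-δ (index y y∈D gy∈D) (λ _ → 1#) ⟨
      ∑[ m < l ] ([ index y y∈D gy∈D Fin.≟ m ] * 1#)
        ≈⟨ sum-cong-≋ (λ m → trans (*-identityʳ _)
             ([]-cong hit unhit (index y y∈D gy∈D Fin.≟ m) (second m ≟ y))) ⟩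
      ∑[ m < l ] [ second m ≟ y ]           ∎
      where
      hit : ∀ {m} → index y y∈D gy∈D ≡ m → second m ≈ᴳ y
      hit ≡.refl = proj₂ (Rep.strictlyInverseʳ _)
      unhit : ∀ {m} → second m ≈ᴳ y → index y y∈D gy∈D ≡ m
      unhit {m} eq = let _ , _ , _ , _ , d₁d₂⁻¹≈g = Rep.from m in
        Rep.inverseˡ (G.sym (G.trans (first≈ d₁d₂⁻¹≈g) (G.∙-congˡ eq)) , G.sym eq)
    pointwise y (no y∉D) d′ = trans (zeroˡ _)
      (sym (sum-≈0 λ m → []-no (second m ≟ y) λ eq → y∉D (proj₁ (second∈ {m} eq))))
    pointwise y (yes _) (no gy∉D) = trans (zeroʳ _)
      (sym (sum-≈0 λ m → []-no (second m ≟ y) λ eq → gy∉D (proj₂ (second∈ {m} eq))))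

  -- The group ring equation D D⁻¹ = λ G + (k - λ) 1, coefficient by coefficient, with λ moved to
  -- the left because a semiring has no subtraction.
  count-≈ : ∀ g → count g + [ ε ≟ g ] * λ# ≈ λ# + [ ε ≟ g ] * κ
  count-≈ g = by (ε ≟ g)
    where
    by : (d : Dec (ε ≈ᴳ g)) → count g + [ d ] * λ# ≈ λ# + [ d ] * κ
    by (yes ε≈g) = trans (+-cong (count-ε (G.sym ε≈g)) (*-identityˡ _))
      (trans (+-comm _ _) (+-congˡ (sym (*-identityˡ _))))
    by (no ε≉g)  = trans (+-cong (count-λ (ε≉g ∘ G.sym)) (zeroˡ _)) (+-congˡ (sym (zeroˡ _)))

  -- Sums of a multiplicative function over G, D and the inverse of D.

  module CharacterSum (χ : G.Carrier → Carrier) (χ-cong : Congruent χ)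
    (χ-ε : χ ε ≈ 1#) (χ-∙ : ∀ x y → χ (x ∙ y) ≈ χ x * χ y) where

    Sᴳ Sᴰ Sᴰ⁻¹ : Carrier
    Sᴳ   = ∑ χ
    Sᴰ   = ∑ λ x → 𝟙 x * χ x
    Sᴰ⁻¹ = ∑ λ x → 𝟙 x * χ (x ⁻¹)

    Sᴰ⁻¹-inverted : Sᴰ⁻¹ ≈ ∑ λ x → 𝟙 (x ⁻¹) * χ x
    Sᴰ⁻¹-inverted = trans (∑-reindex (λ x≈y → *-cong (𝟙-cong x≈y) (χ-cong (G.⁻¹-cong x≈y))) (inversion G))
      (∑-cong λ x → *-congˡ (χ-cong (⁻¹-involutive x)))

    -- Weight `partition` by χ and sum; the identity element contributes χ(ε) = 1.
    sum-partition : 1# + (Sᴰ + Sᴰ⁻¹) ≈ Sᴳ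
    sum-partition = sym (begin
      ∑ χ
        ≈⟨ ∑-cong (λ x → trans (sym (trans (*-congʳ (partition x)) (*-identityˡ _)))
             (solve 4 (λ s t u w → (s :+ t :+ u) :* w := u :* w :+ (s :* w :+ t :* w)) refl
               (𝟙 x) (𝟙 (x ⁻¹)) [ ε ≟ x ] (χ x))) ⟩
      ∑ (λ x → [ ε ≟ x ] * χ x + (𝟙 x * χ x + 𝟙 (x ⁻¹) * χ x))
        ≈⟨ ∑-+ ⟩
      ∑ (λ x → [ ε ≟ x ] * χ x) + ∑ (λ x → 𝟙 x * χ x + 𝟙 (x ⁻¹) * χ x)
        ≈⟨ +-cong (trans (∑-δ χ-cong ε) χ-ε) (∑-+) ⟩
      1# + (Sᴰ + ∑ (λ x → 𝟙 (x ⁻¹) * χ x))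
        ≈⟨ +-congˡ (+-congˡ Sᴰ⁻¹-inverted) ⟨
      1# + (Sᴰ + Sᴰ⁻¹) ∎)

    χ-translate : ∀ g y → χ (g ∙ y) * χ (y ⁻¹) ≈ χ g
    χ-translate g y = trans (sym (χ-∙ _ _)) (χ-cong (//-rightDividesʳ y g))

    -- Substituting x = g y in the first factor collapses χ(x) χ(y⁻¹) to χ(g), and what remains as
    -- the coefficient of χ(g) is `count g`.
    sum-product : Sᴰ * Sᴰ⁻¹ ≈ ∑ λ g → χ g * count g
    sum-product = begin
      Sᴰ * Sᴰ⁻¹
        ≈⟨ ∑-*ˡ Sᴰ ⟩
      ∑ (λ y → Sᴰ * (𝟙 y * χ (y ⁻¹)))
        ≈⟨ ∑-cong (λ y → *-congʳ (∑-reindex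
             (λ x≈y → *-cong (𝟙-cong x≈y) (χ-cong x≈y)) (rightTranslation G y))) ⟩
      ∑ (λ y → ∑ (λ g → 𝟙 (g ∙ y) * χ (g ∙ y)) * (𝟙 y * χ (y ⁻¹)))
        ≈⟨ ∑-cong (λ y → ∑-*ʳ _) ⟩
      ∑ (λ y → ∑ (λ g → 𝟙 (g ∙ y) * χ (g ∙ y) * (𝟙 y * χ (y ⁻¹))))
        ≈⟨ ∑-cong (λ y → ∑-cong λ g → trans
             (solve 4 (λ s t u w → s :* t :* (u :* w) := (t :* w) :* (u :* s)) refl
               (𝟙 (g ∙ y)) (χ (g ∙ y)) (𝟙 y) (χ (y ⁻¹)))
             (*-congʳ (χ-translate g y))) ⟩
      ∑ (λ y → ∑ (λ g → χ g * (𝟙 y * 𝟙 (g ∙ y))))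
        ≈⟨ ∑-swap ⟩
      ∑ (λ g → ∑ (λ y → χ g * (𝟙 y * 𝟙 (g ∙ y))))
        ≈⟨ ∑-cong (λ g → sym (∑-*ˡ (χ g))) ⟩
      ∑ (λ g → χ g * count g) ∎

    ∑-δ-χ : ∀ u → ∑ (λ g → [ ε ≟ g ] * (χ g * u)) ≈ u
    ∑-δ-χ u = trans (∑-δ (*-congʳ ∘ χ-cong) ε) (trans (*-congʳ χ-ε) (*-identityˡ u))

    -- Weight `count-≈` by χ(g) and sum over `g`; the terms at the identity again see χ(ε) = 1.
    difference-set-identity : Sᴰ * Sᴰ⁻¹ + λ# ≈ Sᴳ * λ# + κ
    difference-set-identity = begin
      Sᴰ * Sᴰ⁻¹ + λ#
        ≈⟨ +-cong sum-product (sym (∑-δ-χ λ#)) ⟩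
      ∑ (λ g → χ g * count g) + ∑ (λ g → [ ε ≟ g ] * (χ g * λ#))
        ≈⟨ ∑-+ ⟨
      ∑ (λ g → χ g * count g + [ ε ≟ g ] * (χ g * λ#))
        ≈⟨ ∑-cong (λ g → trans
             (solve 4 (λ s t u w → s :* t :+ u :* (s :* w) := s :* (t :+ u :* w)) refl (χ g) (count g) [ ε ≟ g ] λ#)
             (trans (*-congˡ (count-≈ g))
             (solve 4 (λ s t u w → s :* (t :+ u :* w) := s :* t :+ u :* (s :* w)) refl (χ g) λ# [ ε ≟ g ] κ))) ⟩
      ∑ (λ g → χ g * λ# + [ ε ≟ g ] * (χ g * κ))
        ≈⟨ ∑-+ ⟩
      ∑ (λ g → χ g * λ#) + ∑ (λ g → [ ε ≟ g ] * (χ g * κ))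
        ≈⟨ +-cong (sym (∑-*ʳ λ#)) (∑-δ-χ κ) ⟩
      Sᴳ * λ# + κ ∎

-- Evaluation of the character sums in a field.

module FieldProperties (K : HeytingField f ℓ₁ ℓ₂) where
  open HeytingField K
  open HeytingCommutativeRing heytingCommutativeRing using (commutativeRing) public
  open CommutativeRing commutativeRing
    using (ring; semiring; commutativeSemiring; *-monoid; +-group) public
  open SemiringExp semiring using (_^_) public
  open SetoidReasoning setoid

  ≈-stable : ∀ {x y} → ¬ ¬ (x ≈ y) → x ≈ y
  ≈-stable {x} {y} ¬¬x≈y = proj₁ (tight x y) λ x#y → ¬¬x≈y λ x≈y → proj₂ (tight x y) x≈y x#y

  -- Here `x` is merely unequal to 0, not apart from it, so it cannot be inverted. Instead, `y`
  -- apart from `z` would make y - z invertible and force x = 0; tightness concludes.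
  *-cancelˡ-≉0 : ∀ {x y z} → ¬ (x ≈ 0#) → x * y ≈ x * z → y ≈ z
  *-cancelˡ-≉0 {x} {y} {z} x≉0 xy≈xz = proj₁ (tight y z) λ y#z →
    let u , _ , [y-z]u≈1 = #⇒invertible y#z in x≉0 (begin
      x                      ≈⟨ *-identityʳ x ⟨
      x * 1#                 ≈⟨ *-congˡ [y-z]u≈1 ⟨
      x * ((y - z) * u)      ≈⟨ *-assoc _ _ _ ⟨
      x * (y - z) * u        ≈⟨ *-congʳ (RingProperties.x[y-z]≈xy-xz ring x y z) ⟩
      (x * y - x * z) * u    ≈⟨ *-congʳ (trans (+-congʳ xy≈xz) (-‿inverseʳ _)) ⟩
      0# * u                 ≈⟨ zeroˡ u ⟩
      0#                     ∎)

  ^-∈ℚ⟮⟯ : ∀ {ζ x} n → ℚ⟮_⟯ K ζ x → ℚ⟮_⟯ K ζ (x ^ n)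
  ^-∈ℚ⟮⟯ zero    x∈ = 1∈
  ^-∈ℚ⟮⟯ (suc n) x∈ = *∈ x∈ (^-∈ℚ⟮⟯ n x∈)

  module CharacterValue (G : Group a ℓ) {v : ℕ} (e : HasCardinality (Group.setoid G) v)
    {D : Pred (Group.Carrier G) p} (shds : IsSkewHadamardDifferenceSet G D)
    (char0 : CharacteristicZero K) {q} .{{q≢0 : NonZero q}} (character : Character G q)
    {ξ : Carrier} (ξ^q≈1 : ξ ^ q ≈ 1#) (ξ≉1 : ¬ (ξ ≈ 1#)) where

    open SkewHadamard G e shds commutativeSemiring hiding (sum)
    open SemiringSolver commutativeSemiring using (solve; _:=_; _:+_; _:*_; con)
    open Character character renaming (cong to residue-cong)
    open GroupProperties +-group
      using () renaming (∙-cancelʳ to +-cancelʳ; inverseˡ-unique to -‿inverseˡ-unique)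
    private module G = Group G

    χ : G.Carrier → Carrier
    χ x = ξ ^ residue x

    χ-∙ : ∀ x y → χ (x G.∙ y) ≈ χ x * χ y
    χ-∙ x y = begin
      ξ ^ residue (x G.∙ y)                  ≈⟨ SemiringExp.^-congʳ semiring ξ (homo x y) ⟩
      ξ ^ ((residue x ℕ.+ residue y) ℕ.% q)  ≈⟨ ·-% *-monoid (residue x ℕ.+ residue y) ξ^q≈1 ⟨
      ξ ^ (residue x ℕ.+ residue y)          ≈⟨ SemiringExp.^-homo-* semiring ξ (residue x) (residue y) ⟩
      χ x * χ y                              ∎

    χ-cong : Congruent χ
    χ-cong x≈y = SemiringExp.^-congʳ semiring ξ (residue-cong x≈y)

    χ-ε : χ G.ε ≈ 1#
    χ-ε = SemiringExp.^-congʳ semiring ξ ε-homo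

    module Trivial = CharacterSum (λ _ → 1#) (λ _ → refl) refl (λ _ _ → sym (*-identityˡ 1#))
    module χ = CharacterSum χ χ-cong χ-ε χ-∙

    -- Translation by an element with character value ξ multiplies the sum by ξ; a nonzero sum could
    -- be cancelled, giving ξ = 1.
    χ-sum≈0 : χ.Sᴳ ≈ 0#
    χ-sum≈0 = ≈-stable λ Sᴳ≉0 → ξ≉1 (*-cancelˡ-≉0 Sᴳ≉0 (begin
      χ.Sᴳ * ξ                     ≈⟨ ∑-*ʳ ξ ⟩
      ∑ (λ x → χ x * ξ)            ≈⟨ ∑-cong (λ x → *-congˡ ξ≈χ) ⟩
      ∑ (λ x → χ x * χ x₁)         ≈⟨ ∑-cong (λ x → χ-∙ x x₁) ⟨
      ∑ (λ x → χ (x G.∙ x₁))       ≈⟨ ∑-reindex χ-cong (rightTranslation G x₁) ⟨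
      χ.Sᴳ                         ≈⟨ *-identityʳ _ ⟨
      χ.Sᴳ * 1#                    ∎))
      where
      x₁ : G.Carrier
      x₁ = proj₁ attains1
      ξ≈χ : ξ ≈ χ x₁
      ξ≈χ = sym (trans (SemiringExp.^-congʳ semiring ξ (proj₂ attains1)) (*-identityʳ ξ))

    V : Carrier
    V = fromℕ K v

    trivial-D : Trivial.Sᴰ ≈ κ
    trivial-D = ∑-cong λ x → *-identityʳ _

    trivial-D⁻¹ : Trivial.Sᴰ⁻¹ ≈ κ
    trivial-D⁻¹ = ∑-cong λ x → *-identityʳ _

    2κ+1≈V : 1# + (κ + κ) ≈ V
    2κ+1≈V = trans (+-congˡ (sym (+-cong trivial-D trivial-D⁻¹))) (trans Trivial.sum-partition ∑-1)

    -- The residues 0 and 1 both occur, so G has at least two elements; for v = n + 2 the equation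
    -- would give n + 1 = 0 in characteristic zero.
    V≉1 : ¬ (V ≈ 1#)
    V≉1 = bad v e
      where
      bad : ∀ v → HasCardinality G.setoid v → ¬ (fromℕ K v ≈ 1#)
      bad zero          e _   = contradiction (Inverse.to e G.ε) λ ()
      bad (suc zero)    e _   = contradiction
        (≡.trans (≡.sym (proj₂ attains1)) (≡.trans (residue-cong (to-injective e (≡-Fin1 _ _))) ε-homo)) λ ()
        where
        ≡-Fin1 : (i j : Fin 1) → i ≡ j
        ≡-Fin1 zero zero = ≡.refl
      bad (suc (suc n)) e V≈1 = proj₂ (tight _ _)
        (+-cancelʳ 1# _ _ (trans (+-comm _ 1#) (trans V≈1 (sym (+-identityˡ 1#))))) (char0 (suc n) z<s)

    κ≉0 : ¬ (κ ≈ 0#)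
    κ≉0 κ≈0 = V≉1 (trans (sym 2κ+1≈V)
      (trans (+-congˡ (trans (+-cong κ≈0 κ≈0) (+-identityˡ 0#))) (+-identityʳ 1#)))

    -- For the trivial character the difference set identity reads k² + λ = v λ + k. With v = 2k + 1
    -- it becomes k² + λ = k (2λ + 1) + λ, and k is cancelled.
    κ≈2λ+1 : κ ≈ 1# + (λ# + λ#)
    κ≈2λ+1 = *-cancelˡ-≉0 κ≉0 (+-cancelʳ λ# _ _ (begin
      κ * κ + λ#                              ≈⟨ +-congʳ (*-cong trivial-D trivial-D⁻¹) ⟨
      Trivial.Sᴰ * Trivial.Sᴰ⁻¹ + λ#          ≈⟨ Trivial.difference-set-identity ⟩
      Trivial.Sᴳ * λ# + κ                     ≈⟨ +-congʳ (*-congʳ (trans ∑-1 (sym 2κ+1≈V))) ⟩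
      (1# + (κ + κ)) * λ# + κ
        ≈⟨ solve 2 (λ k l → (con 1 :+ (k :+ k)) :* l :+ k := k :* (con 1 :+ (l :+ l)) :+ l) refl κ λ# ⟩
      κ * (1# + (λ# + λ#)) + λ#               ∎))

    α : Carrier
    α = 1# + (χ.Sᴰ + χ.Sᴰ)

    -- Modulo S + S̄ = -1 and S S̄ = κ - λ; both sides are moved so that no
    -- subtraction occurs.
    α²+V≈0 : α * α + V ≈ 0#
    α²+V≈0 = +-cancelʳ (4S̄S+4λ) _ _ (begin
      α * α + V + 4S̄S+4λ
        ≈⟨ +-congʳ (+-congˡ 2κ+1≈V) ⟨
      α * α + (1# + (κ + κ)) + 4S̄S+4λ
        -- All terms in S are collected into a multiple of 1 + S + S̄, which vanishes.
        ≈⟨ solve 4 (λ s s̄ k l →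
             (con 1 :+ (s :+ s)) :* (con 1 :+ (s :+ s)) :+ (con 1 :+ (k :+ k)) :+ con 4 :* (s :* s̄ :+ l)
               := con 4 :* s :* (con 1 :+ (s :+ s̄)) :+ (con 2 :* (k :+ (con 1 :+ (l :+ l)))))
             refl χ.Sᴰ χ.Sᴰ⁻¹ κ λ# ⟩
      4# * χ.Sᴰ * (1# + (χ.Sᴰ + χ.Sᴰ⁻¹)) + 2# * (κ + (1# + (λ# + λ#)))
        ≈⟨ +-cong (trans (*-congˡ (trans χ.sum-partition χ-sum≈0)) (zeroʳ _)) (*-congˡ (+-congˡ (sym κ≈2λ+1))) ⟩
      0# + 2# * (κ + κ)
        -- The inner zero makes room for `χ.Sᴳ * λ#`; the outer one survives as the right-hand side
        -- after cancellation.
        ≈⟨ solve 1 (λ k → con 0 :+ con 2 :* (k :+ k) := con 0 :+ con 4 :* (con 0 :+ k)) refl κ ⟩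
      0# + 4# * (0# + κ)
        ≈⟨ +-congˡ (*-congˡ (+-congʳ (trans (*-congʳ χ-sum≈0) (zeroˡ _)))) ⟨
      0# + 4# * (χ.Sᴳ * λ# + κ)
        ≈⟨ +-congˡ (*-congˡ χ.difference-set-identity) ⟨
      0# + 4S̄S+4λ ∎)
      where
      2# 4# 4S̄S+4λ : Carrier
      2# = 1# + 1#
      4# = 1# + 1# + 1# + 1#
      4S̄S+4λ = 4# * (χ.Sᴰ * χ.Sᴰ⁻¹ + λ#)

    α²≈-V : α * α ≈ - V
    α²≈-V = -‿inverseˡ-unique _ _ α²+V≈0

    α∈ℚ⟮⟯ : ∀ {ζ} → ℚ⟮_⟯ K ζ ξ → ℚ⟮_⟯ K ζ α
    α∈ℚ⟮⟯ {ζ} ξ∈ = +∈ 1∈ (+∈ S∈ S∈)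
      where
      𝟙∈ : ∀ x → ℚ⟮_⟯ K ζ (𝟙 x)
      𝟙∈ x with D? x
      ... | yes _ = 1∈
      ... | no _  = 0∈
      S∈ : ℚ⟮_⟯ K ζ χ.Sᴰ
      S∈ = ∑-∈ {P = ℚ⟮_⟯ K ζ} 0∈ +∈ λ x → *∈ (𝟙∈ x) (^-∈ℚ⟮⟯ (residue x) ξ∈)

-- Choice of the prime and of the root of unity.

theorem2p2 : ∀ {a ℓ p f ℓ₁ ℓ₂ : Level}
    (G : Group a ℓ) (v : ℕ) → HasCardinality (Group.setoid G) v →
    AdmitsSHDS p G →
    (d : ℕ) → 1 < d → HasCyclicSubgroupOfOrder (abelianization G) d →
    (K : HeytingField f ℓ₁ ℓ₂) → CharacteristicZero K →
    (ζ : HeytingField.Carrier K) → IsPrimitiveRoot K d ζ →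
    let open HeytingField K in
    ∃ λ α → α ∈ ℚ⟮_⟯ K ζ × α * α ≈ - fromℕ K v
theorem2p2 G v e (D , shds) d 1<d cyclic K char0 ζ (ζ^d≈1 , ζ^j≉1)
  with prime-divisor d 1<d
... | q , pr , divides zero d≡0 = contradiction (≡.subst (1 <_) d≡0 1<d) λ ()
... | q , pr , q∣d@(divides m@(suc _) d≡mq) =
  -- The role of ξ is played by `ζ ^ m` with m = d/q: its q-th power is 1, and it differs from 1
  -- because 0 < m < d.
  α , α∈ℚ⟮⟯ (^-∈ℚ⟮⟯ m ζ∈) , α²≈-V
  where
  open HeytingField K
  open FieldProperties K
  instance
    q≢0 : NonZero q
    q≢0 = prime⇒nonZero pr
  character : Character G q
  character = abelianization-character G e 1<d cyclic pr q∣d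
  ξ^q≈1 : (ζ ^ m) ^ q ≈ 1#
  ξ^q≈1 = trans (SemiringExp.^-assocʳ semiring ζ m q)
    (trans (SemiringExp.^-congʳ semiring ζ (≡.sym d≡mq)) ζ^d≈1)
  ξ≉1 : ¬ (ζ ^ m ≈ 1#)
  ξ≉1 = ζ^j≉1 m z<s (≡.subst (m <_) (≡.sym d≡mq) (ℕ.m<m*n m q (1<prime pr)))
  open CharacterValue G e shds char0 character ξ^q≈1 ξ≉1 using (α; α∈ℚ⟮⟯; α²≈-V)
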